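{- The following two inequalities hold: $$\frac{1}{(q,q^4,q^5,q^9,q^{11};q^{12})_{\infty}} - \frac{1}{(q,q^5,q^7,q^8,q^9;q^{12})_{\infty}} \succeq 0,$$ $$\frac{1}{(q,q^3,q^7,q^8,q^{11};q^{12})_{\infty}} - \frac{1}{(q^3,q^4,q^5,q^7,q^{11};q^{12})_{\infty}} \succeq 0.$$
   Context: Notation: $(x;q)_\infty := \prod_{j=0}^{\infty}(1-xq^j)$ and $(x_1,\dots,x_r;q)_\infty := (x_1;q)_\infty\cdots(x_r;q)_\infty$; thus $(q^{s_1},\dots,q^{s_r};q^{12})_\infty=\prod_{j\ge 0}\prod_{i=1}^r(1-q^{12j+s_i})$. Quotients are expanded as formal power series in $q$. For a power series $f(q)=\sum_{n\ge 0}a_nq^n$, $f(q)\succeq 0$ means $a_n\geq 0$ for all $n$. -}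

module Defs where

open import Data.Nat.Base as ℕ using (ℕ; zero; suc; _∸_; z≤n; s≤s)
import Data.Nat.Properties as ℕ
open import Data.Integer.Base as ℤ using (ℤ; 0ℤ; 1ℤ)
import Data.Integer.Properties as ℤ
open import Data.Fin.Base using (Fin; zero; suc; toℕ)
import Data.Fin.Properties as Fin
open import Data.List.Base using (List; []; _∷_; foldr; map)
open import Data.List.Relation.Unary.All using (All; []; _∷_)
open import Relation.Binary.PropositionalEquality
open import Algebra.Properties.CommutativeMonoid.Sum ℤ.+-0-commutativeMonoid
  using (sum; sum-cong-≗; sum-replicate-zero)

infix  4 _⪰0
infixl 6 _-_
infixl 7 _*_
infixr 8 _^_
infix  9 1/_

-- Formal power series over ℤ, given by their coefficient sequences.
PowerSeries : Set
PowerSeries = ℕ → ℤ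

1# : PowerSeries
1# zero    = 1ℤ
1# (suc _) = 0ℤ

q : PowerSeries
q (suc zero) = 1ℤ
q _          = 0ℤ

_-_ : PowerSeries → PowerSeries → PowerSeries
(f - g) n = f n ℤ.- g n

_*_ : PowerSeries → PowerSeries → PowerSeries
(f * g) n = sum {suc n} λ i → f (toℕ i) ℤ.* g (n ∸ toℕ i)

_^_ : PowerSeries → ℕ → PowerSeries
f ^ zero  = 1#
f ^ suc n = f * f ^ n

_⪰0 : PowerSeries → Set
f ⪰0 = ∀ n → 0ℤ ℤ.≤ f n

-- recips f n lists the coefficients n-1, n-2, …, 0 of 1/f, obtained by solving
-- f * g = 1 for g recursively under the assumption f 0 = 1.
recips : PowerSeries → (n : ℕ) → Fin n → ℤ
recips f (suc n) zero    = 1# n ℤ.- sum {n} λ i → f (suc (toℕ i)) ℤ.* recips f n i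
recips f (suc n) (suc i) = recips f n i

-- Meaningful only for series with constant term 1; see 1/-inverseʳ.
1/_ : PowerSeries → PowerSeries
(1/ f) n = recips f (suc n) zero

-- (x;p)ₙ = ∏_{0≤j<n} (1 - x pʲ)
⟨_⨾_⟩ : PowerSeries → PowerSeries → ℕ → PowerSeries
⟨ x ⨾ p ⟩ zero    = 1#
⟨ x ⨾ p ⟩ (suc n) = ⟨ x ⨾ p ⟩ n * (1# - x * p ^ n)

-- (x;p)_∞, the coefficientwise limit of (x;p)ₘ as m → ∞. When p has zero
-- constant term, the n-th coefficient is constant for m > n; see
-- ⟨⨾⟩-stable.
pochhammer∞ : PowerSeries → PowerSeries → PowerSeries
pochhammer∞ x p n = ⟨ x ⨾ p ⟩ (suc n) n

-- (x₁,…,xᵣ;p)_∞ = (x₁;p)_∞ ⋯ (xᵣ;p)_∞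
⟨_⨾_⟩∞ : List PowerSeries → PowerSeries → PowerSeries
⟨ xs ⨾ p ⟩∞ = foldr _*_ 1# (map (λ x → pochhammer∞ x p) xs)


recips-1/ : ∀ f n (i : Fin n) → recips f n i ≡ (1/ f) (n ∸ suc (toℕ i))
recips-1/ f (suc n) zero    = refl
recips-1/ f (suc n) (suc i) = recips-1/ f n i

sum-zero : ∀ n (t : Fin n → ℤ) → (∀ i → t i ≡ 0ℤ) → sum t ≡ 0ℤ
sum-zero n t t≡0 = trans (sum-cong-≗ t≡0) (sum-replicate-zero n)

*-congʳ-≤ : ∀ f {g h} n → (∀ k → k ℕ.≤ n → g k ≡ h k) → (f * g) n ≡ (f * h) n
*-congʳ-≤ f n g≡h = sum-cong-≗ {suc n} λ i →
  cong (f (toℕ i) ℤ.*_) (g≡h (n ∸ toℕ i) (ℕ.m∸n≤m n (toℕ i)))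

*-identityʳ : ∀ f n → (f * 1#) n ≡ f n
*-identityʳ f zero    = trans (ℤ.+-identityʳ _) (ℤ.*-identityʳ _)
*-identityʳ f (suc n) = trans
  (cong₂ ℤ._+_ (ℤ.*-zeroʳ (f 0)) (*-identityʳ (λ k → f (suc k)) n))
  (ℤ.+-identityˡ _)

*-vanish : ∀ f {g} m → (∀ k → k ℕ.< m → g k ≡ 0ℤ) →
           ∀ k → k ℕ.< m → (f * g) k ≡ 0ℤ
*-vanish f m g≡0 k k<m = sum-zero (suc k) _ λ i → trans
  (cong (f (toℕ i) ℤ.*_) (g≡0 _ (ℕ.≤-<-trans (ℕ.m∸n≤m k (toℕ i)) k<m)))
  (ℤ.*-zeroʳ (f (toℕ i)))

^-vanish : ∀ p → p 0 ≡ 0ℤ → ∀ m k → k ℕ.< m → (p ^ m) k ≡ 0ℤ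
^-vanish p p₀ (suc m) k (s≤s k≤m) = sum-zero (suc k) _ term
  where
  term : (i : Fin (suc k)) → p (toℕ i) ℤ.* (p ^ m) (k ∸ toℕ i) ≡ 0ℤ
  term zero    = cong (ℤ._* (p ^ m) k) p₀
  term (suc i) = trans
    (cong (p (suc (toℕ i)) ℤ.*_) (^-vanish p p₀ m _
      (ℕ.<-≤-trans (ℕ.∸-monoʳ-< (s≤s z≤n) i<k) k≤m)))
    (ℤ.*-zeroʳ (p (suc (toℕ i))))
    where i<k = Fin.toℕ<n i

1/-inverseʳ : ∀ f → f 0 ≡ 1ℤ → ∀ n → (f * 1/ f) n ≡ 1# n
1/-inverseʳ f f₀ n = begin
  f 0 ℤ.* (1/ f) n ℤ.+ sum {n} (λ i → f (suc (toℕ i)) ℤ.* (1/ f) (n ∸ suc (toℕ i)))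
    ≡⟨ cong₂ ℤ._+_
         (trans (cong (ℤ._* (1/ f) n) f₀) (ℤ.*-identityˡ ((1/ f) n)))
         (sum-cong-≗ {n} λ i → cong (f (suc (toℕ i)) ℤ.*_) (sym (recips-1/ f n i))) ⟩
  (1# n ℤ.- s) ℤ.+ s
    ≡⟨ ℤ.+-assoc (1# n) (ℤ.- s) s ⟩
  1# n ℤ.+ (ℤ.- s ℤ.+ s)
    ≡⟨ cong (ℤ._+_ (1# n)) (ℤ.+-inverseˡ s) ⟩
  1# n ℤ.+ 0ℤ
    ≡⟨ ℤ.+-identityʳ (1# n) ⟩
  1# n ∎
  where
  open ≡-Reasoning
  s = sum {n} λ i → f (suc (toℕ i)) ℤ.* recips f n i

⟨⨾⟩-stable : ∀ x p → p 0 ≡ 0ℤ → ∀ {n m} → n ℕ.< m →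
             ⟨ x ⨾ p ⟩ m n ≡ pochhammer∞ x p n
⟨⨾⟩-stable x p p₀ {n} n<m = go (ℕ.≤⇒≤′ n<m)
  where
  step : ∀ m → n ℕ.< m → ⟨ x ⨾ p ⟩ (suc m) n ≡ ⟨ x ⨾ p ⟩ m n
  step m n<m = trans
    (*-congʳ-≤ (⟨ x ⨾ p ⟩ m) n λ k k≤n → trans
      (cong (ℤ._-_ (1# k)) (*-vanish x m (^-vanish p p₀ m) k (ℕ.≤-<-trans k≤n n<m)))
      (ℤ.+-identityʳ (1# k)))
    (*-identityʳ (⟨ x ⨾ p ⟩ m) n)

  go : ∀ {m} → suc n ℕ.≤′ m → ⟨ x ⨾ p ⟩ m n ≡ pochhammer∞ x p n
  go ℕ.≤′-refl         = refl
  go (ℕ.≤′-step n<′m) = trans (step _ (ℕ.≤′⇒≤ n<′m)) (go n<′m)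

⟨⨾⟩∞-constant : ∀ {xs} p → All (λ x → x 0 ≡ 0ℤ) xs → ⟨ xs ⨾ p ⟩∞ 0 ≡ 1ℤ
⟨⨾⟩∞-constant p []         = refl
⟨⨾⟩∞-constant p (x₀ ∷ xs₀)
  rewrite x₀ | ⟨⨾⟩∞-constant p xs₀ = refl

{-# OPTIONS --safe #-}

-- Dropping the three common factors, both inequalities compare
-- ∏ⱼ 1/((1 - xⱼ)(1 - xⱼyz)) with ∏ⱼ 1/((1 - xⱼy)(1 - xⱼz)), where y = q³,
-- z = q⁴ and xⱼ = q¹²ʲ⁺ˢ, with s = 4 in the first and s = 1 in the second.
-- The numerators differ by xⱼ(1 - y)(1 - z), so replacing the factors one j at
-- a time writes the difference as a sum of products whose only negative
-- contributions are 1 - y and 1 - z. The former is absorbed by a common factor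
-- (1 - q resp. 1 - q³ divides 1 - q³), the latter by 1 - x₀ (1 - q⁴
-- resp. 1 - q divides 1 - q⁴), which is present in every summand.

module Submission where

open import Defs
open import Algebra.Bundles using (CommutativeMonoid; CommutativeRing)
open import Algebra.Solver.Ring.AlmostCommutativeRing
  using (fromCommutativeRing; _-Raw-AlmostCommutative⟶_)
import Algebra.Solver.CommutativeMonoid
import Algebra.Solver.Ring
open import Data.Fin.Base using (Fin; zero; suc; toℕ)
import Data.Fin.Properties as Fin
open import Data.Integer.Base as ℤ using (ℤ; 0ℤ; 1ℤ; +_; -[1+_]; +≤+)
import Data.Integer.Properties as ℤ
open import Data.Integer.Tactic.RingSolver using (solve-∀)
open import Data.List.Base using (List; []; _∷_; foldr; map)
open import Data.List.Relation.Unary.All using (All; []; _∷_)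
open import Data.List.Relation.Binary.Permutation.Propositional
  using (_↭_; prep; swap) renaming (refl to ↭-refl; trans to ↭-trans)
open import Data.List.Relation.Binary.Permutation.Propositional.Properties using (shift)
open import Data.Maybe.Base as Maybe using (Maybe)
open import Data.Nat.Base as ℕ using (ℕ; zero; suc; _∸_; z≤n; s≤s)
import Data.Nat.Properties as ℕ
open import Data.Product.Base using (_×_; _,_)
open import Function.Base using (_∘_)
open import Level using (0ℓ)
open import Relation.Binary.Consequences using (dec⇒weaklyDec)
import Relation.Binary.Reasoning.Setoid as SetoidReasoning
open import Relation.Binary.PropositionalEquality
  using (_≡_; refl; sym; trans; cong; cong₂; subst)
open import Algebra.Properties.CommutativeMonoid.Sum ℤ.+-0-commutativeMonoid
  using (sum; sum-cong-≗)

infix  4 _≈_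
infixl 6 _+_
infixl 7 _·_
infix  8 -_

-- Over an abstract monoid, because on power series comparing the solver's normal
-- forms unfolds the convolutions.
module _ {c ℓ} (M : CommutativeMonoid c ℓ) where
  open CommutativeMonoid M using (_∙_) renaming (_≈_ to _≋_; refl to ≋-refl)
  open Algebra.Solver.CommutativeMonoid M

  antitelescope-term : ∀ s u t y z a b →
    (s ∙ u) ∙ ((t ∙ (y ∙ z)) ∙ (a ∙ b)) ≋ ((y ∙ s) ∙ (z ∙ (u ∙ a))) ∙ (t ∙ b)
  antitelescope-term = solve 7 (λ s u t y z a b →
    (s ⊕ u) ⊕ ((t ⊕ (y ⊕ z)) ⊕ (a ⊕ b)) ⊜ ((y ⊕ s) ⊕ (z ⊕ (u ⊕ a))) ⊕ (t ⊕ b)) ≋-refl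

-- A record instead of the bare function type, so that unification can recover both series from the
-- type of an equation.
record _≈_ (f g : PowerSeries) : Set where
  constructor pointwise
  field coeff : ∀ n → f n ≡ g n

open _≈_

0# : PowerSeries
0# _ = 0ℤ

_+_ : PowerSeries → PowerSeries → PowerSeries
(f + g) n = f n ℤ.+ g n

-_ : PowerSeries → PowerSeries
(- f) n = ℤ.- f n

_·_ : ℤ → PowerSeries → PowerSeries
(c · f) n = c ℤ.* f n

tail : PowerSeries → PowerSeries
tail f n = f (suc n)

-- The commutative ring of power series

-- The recursion (f * g) (1 + n) = f 0 * g (1 + n) + (tail f * g) n holds
-- definitionally; this is its mirror image.
*-sucʳ : ∀ f g n → (f * g) (suc n) ≡ (f * tail g) n ℤ.+ f (suc n) ℤ.* g 0
*-sucʳ f g zero    = base (f 0) (g 1) (f 1) (g 0)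
  where
  base : ∀ a b c d → a ℤ.* b ℤ.+ (c ℤ.* d ℤ.+ 0ℤ) ≡ a ℤ.* b ℤ.+ 0ℤ ℤ.+ c ℤ.* d
  base = solve-∀
*-sucʳ f g (suc n) = trans
  (cong (ℤ._+_ (f 0 ℤ.* g (suc (suc n)))) (*-sucʳ (tail f) g n))
  (sym (ℤ.+-assoc (f 0 ℤ.* g (suc (suc n))) _ _))

*-comm : ∀ f g n → (f * g) n ≡ (g * f) n
*-comm f g zero    = cong (ℤ._+ 0ℤ) (ℤ.*-comm (f 0) (g 0))
*-comm f g (suc n) = trans
  (cong₂ ℤ._+_ (ℤ.*-comm (f 0) (g (suc n))) (*-comm (tail f) g n))
  (trans (ℤ.+-comm (g (suc n) ℤ.* f 0) _) (sym (*-sucʳ g f n)))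

*-distribʳ : ∀ h f g n → ((f + g) * h) n ≡ (f * h) n ℤ.+ (g * h) n
*-distribʳ h f g zero    = base (f 0) (g 0) (h 0)
  where
  base : ∀ a b c → (a ℤ.+ b) ℤ.* c ℤ.+ 0ℤ ≡ a ℤ.* c ℤ.+ 0ℤ ℤ.+ (b ℤ.* c ℤ.+ 0ℤ)
  base = solve-∀
*-distribʳ h f g (suc n) = trans
  (cong (ℤ._+_ ((f 0 ℤ.+ g 0) ℤ.* h (suc n))) (*-distribʳ h (tail f) (tail g) n))
  (step (f 0) (g 0) (h (suc n)) ((tail f * h) n) ((tail g * h) n))
  where
  step : ∀ a b c u v →
         (a ℤ.+ b) ℤ.* c ℤ.+ (u ℤ.+ v) ≡ a ℤ.* c ℤ.+ u ℤ.+ (b ℤ.* c ℤ.+ v)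
  step = solve-∀

·-*-assoc : ∀ c f g n → ((c · f) * g) n ≡ c ℤ.* (f * g) n
·-*-assoc c f g zero    = base c (f 0) (g 0)
  where
  base : ∀ a b c → (a ℤ.* b) ℤ.* c ℤ.+ 0ℤ ≡ a ℤ.* (b ℤ.* c ℤ.+ 0ℤ)
  base = solve-∀
·-*-assoc c f g (suc n) = trans
  (cong (ℤ._+_ (c ℤ.* f 0 ℤ.* g (suc n))) (·-*-assoc c (tail f) g n))
  (step c (f 0) (g (suc n)) ((tail f * g) n))
  where
  step : ∀ a b c u → (a ℤ.* b) ℤ.* c ℤ.+ a ℤ.* u ≡ a ℤ.* (b ℤ.* c ℤ.+ u)
  step = solve-∀

-- Induction on the degree: `tail (f * g)` is by definition `f 0 · tail g + tail f * g`, so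
-- distributivity and scaling reduce the claim to `tail f`.
*-assoc : ∀ f g h n → ((f * g) * h) n ≡ (f * (g * h)) n
*-assoc f g h zero    = base (f 0) (g 0) (h 0)
  where
  base : ∀ a b c → (a ℤ.* b ℤ.+ 0ℤ) ℤ.* c ℤ.+ 0ℤ ≡ a ℤ.* (b ℤ.* c ℤ.+ 0ℤ) ℤ.+ 0ℤ
  base = solve-∀
*-assoc f g h (suc n) = trans
  (cong (ℤ._+_ ((f 0 ℤ.* g 0 ℤ.+ 0ℤ) ℤ.* h (suc n)))
    (trans (*-distribʳ h (f 0 · tail g) (tail f * g) n)
      (cong₂ ℤ._+_ (·-*-assoc (f 0) (tail g) h n) (*-assoc (tail f) g h n))))
  (step (f 0) (g 0) (h (suc n)) ((tail g * h) n) ((tail f * (g * h)) n))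
  where
  step : ∀ a b c u v → (a ℤ.* b ℤ.+ 0ℤ) ℤ.* c ℤ.+ (a ℤ.* u ℤ.+ v)
                     ≡ a ℤ.* (b ℤ.* c ℤ.+ u) ℤ.+ v
  step = solve-∀

-- Bounded form of congruence: a truncated product agrees with the infinite one only in low degrees.
*-cong-≤ : ∀ {f f′ g g′} n → (∀ k → k ℕ.≤ n → f k ≡ f′ k) →
           (∀ k → k ℕ.≤ n → g k ≡ g′ k) → (f * g) n ≡ (f′ * g′) n
*-cong-≤ {f} {f′} {g} {g′} n f≡f′ g≡g′ = trans
  (*-congʳ-≤ f n g≡g′)
  (trans (*-comm f g′ n) (trans (*-congʳ-≤ g′ n f≡f′) (*-comm g′ f′ n)))

powerSeriesRing : CommutativeRing 0ℓ 0ℓ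
powerSeriesRing = record
  { Carrier = PowerSeries ; _≈_ = _≈_ ; _+_ = _+_ ; _*_ = _*_ ; -_ = -_
  ; 0# = 0# ; 1# = 1#
  ; isCommutativeRing = record
    { isRing = record
      { +-isAbelianGroup = record
        { isGroup = record
          { isMonoid = record
            { isSemigroup = record
              { isMagma = record
                { isEquivalence = record
                  { refl  = pointwise λ _ → refl
                  ; sym   = λ f≈g → pointwise λ n → sym (coeff f≈g n)
                  ; trans = λ f≈g g≈h → pointwise λ n → trans (coeff f≈g n) (coeff g≈h n)
                  }
                ; ∙-cong = λ f≈f′ g≈g′ → pointwise λ n →
                    cong₂ ℤ._+_ (coeff f≈f′ n) (coeff g≈g′ n)
                }
              ; assoc = λ f g h → pointwise λ n → ℤ.+-assoc (f n) (g n) (h n)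
              }
            ; identity = (λ f → pointwise λ n → ℤ.+-identityˡ (f n))
                       , (λ f → pointwise λ n → ℤ.+-identityʳ (f n))
            }
          ; inverse = (λ f → pointwise λ n → ℤ.+-inverseˡ (f n))
                    , (λ f → pointwise λ n → ℤ.+-inverseʳ (f n))
          ; ⁻¹-cong = λ f≈g → pointwise λ n → cong ℤ.-_ (coeff f≈g n)
          }
        ; comm = λ f g → pointwise λ n → ℤ.+-comm (f n) (g n)
        }
      ; *-cong = λ f≈f′ g≈g′ → pointwise λ n →
          *-cong-≤ n (λ k _ → coeff f≈f′ k) (λ k _ → coeff g≈g′ k)
      ; *-assoc = λ f g h → pointwise (*-assoc f g h)
      ; *-identity = (λ f → pointwise λ n → trans (*-comm 1# f n) (*-identityʳ f n))
                   , (λ f → pointwise (*-identityʳ f))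
      ; distrib = (λ h f g → pointwise λ n → trans (*-comm h (f + g) n)
                    (trans (*-distribʳ h f g n)
                      (cong₂ ℤ._+_ (*-comm f h n) (*-comm g h n))))
                , (λ h f g → pointwise (*-distribʳ h f g))
      }
    ; *-comm = λ f g → pointwise (*-comm f g)
    }
  }

private
  module R = CommutativeRing powerSeriesRing

open SetoidReasoning R.setoid
open import Algebra.Properties.CommutativeSemigroup R.*-commutativeSemigroup using (interchange; x∙yz≈y∙xz)

-- The separate clause makes constant 1ℤ reduce to 1#, so that the ring solver's
-- constant 1 matches the 1# in its goals.
constant : ℤ → PowerSeries
constant (+ 1) = 1#
constant c     = c · 1#

constant≈· : ∀ c → constant c ≈ c · 1#
constant≈· (+ 0)           = R.refl
constant≈· (+ 1)           = pointwise λ n → sym (ℤ.*-identityˡ (1# n))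
constant≈· (+ suc (suc _)) = R.refl
constant≈· -[1+ _ ]        = R.refl

-- Integer coefficients allow the ring solver to cancel terms of opposite sign.
constant-homomorphism :
  CommutativeRing.rawRing ℤ.+-*-commutativeRing
    -Raw-AlmostCommutative⟶ fromCommutativeRing powerSeriesRing
constant-homomorphism = record
  { ⟦_⟧    = constant
  ; +-homo = λ a b → R.trans (constant≈· (a ℤ.+ b)) (R.trans
      (pointwise λ n → ℤ.*-distribʳ-+ (1# n) a b)
      (R.sym (R.+-cong (constant≈· a) (constant≈· b))))
  ; *-homo = λ a b → R.trans (constant≈· (a ℤ.* b)) (R.trans
      (pointwise λ n → trans (ℤ.*-assoc a b (1# n))
        (sym (trans (·-*-assoc a 1# (b · 1#) n)
          (cong (a ℤ.*_) (coeff (R.*-identityˡ (b · 1#)) n)))))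
      (R.sym (R.*-cong (constant≈· a) (constant≈· b))))
  ; -‿homo = λ a → R.trans (constant≈· (ℤ.- a)) (R.trans
      (pointwise λ n → sym (ℤ.neg-distribˡ-* a (1# n)))
      (R.sym (R.-‿cong (constant≈· a))))
  ; 0-homo = pointwise λ _ → refl
  ; 1-homo = R.refl
  }

constant-≟ : ∀ a b → Maybe (constant a ≈ constant b)
constant-≟ a b = Maybe.map (λ { refl → R.refl }) (dec⇒weaklyDec ℤ._≟_ a b)

module Solver = Algebra.Solver.Ring
  (CommutativeRing.rawRing ℤ.+-*-commutativeRing)
  (fromCommutativeRing powerSeriesRing)
  constant-homomorphism
  constant-≟
open Solver using (solve; _:=_; _:+_; _:*_; _:-_; con)

-- Reciprocals

recips-cong : ∀ {f g} n → (∀ k → k ℕ.< n → f k ≡ g k) →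
              ∀ i → recips f n i ≡ recips g n i
recips-cong (suc n) f≡g zero    = cong (ℤ._-_ (1# n)) (sum-cong-≗ {n} λ i →
  cong₂ ℤ._*_ (f≡g _ (s≤s (Fin.toℕ<n i)))
    (recips-cong n (λ k k<n → f≡g k (ℕ.m<n⇒m<1+n k<n)) i))
recips-cong (suc n) f≡g (suc i) =
  recips-cong n (λ k k<n → f≡g k (ℕ.m<n⇒m<1+n k<n)) i

1/-cong-≤ : ∀ {f g} n → (∀ k → k ℕ.≤ n → f k ≡ g k) → (1/ f) n ≡ (1/ g) n
1/-cong-≤ n f≡g = recips-cong (suc n) (λ { k (s≤s k≤n) → f≡g k k≤n }) zero

1/-cong : ∀ {f g} → f ≈ g → 1/ f ≈ 1/ g
1/-cong f≈g = pointwise λ n → 1/-cong-≤ n λ k _ → coeff f≈g k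

*-constant : ∀ f g → f 0 ≡ 1ℤ → g 0 ≡ 1ℤ → (f * g) 0 ≡ 1ℤ
*-constant f g f₀ g₀ rewrite f₀ | g₀ = refl

-- Evaluate (1/f) f g in two ways; the condition on `f 0` makes `1/ f` an inverse of `f`.
1/-unique : ∀ f g → f 0 ≡ 1ℤ → f * g ≈ 1# → 1/ f ≈ g
1/-unique f g f₀ fg≈1 = begin
  1/ f            ≈⟨ R.*-identityʳ (1/ f) ⟨
  1/ f * 1#       ≈⟨ R.*-congˡ {1/ f} fg≈1 ⟨
  1/ f * (f * g)  ≈⟨ solve 3 (λ i f g → i :* (f :* g) := (f :* i) :* g) R.refl (1/ f) f g ⟩
  f * 1/ f * g    ≈⟨ R.*-congʳ {g} (pointwise (1/-inverseʳ f f₀)) ⟩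
  1# * g          ≈⟨ R.*-identityˡ g ⟩
  g               ∎

1/1# : 1/ 1# ≈ 1#
1/1# = 1/-unique 1# 1# refl (R.*-identityˡ 1#)

1/-*-homo : ∀ f g → f 0 ≡ 1ℤ → g 0 ≡ 1ℤ → 1/ (f * g) ≈ 1/ f * 1/ g
1/-*-homo f g f₀ g₀ = 1/-unique (f * g) (1/ f * 1/ g) (*-constant f g f₀ g₀) (begin
  f * g * (1/ f * 1/ g)
    ≈⟨ interchange f g (1/ f) (1/ g) ⟩
  f * 1/ f * (g * 1/ g)
    ≈⟨ R.*-cong (pointwise (1/-inverseʳ f f₀)) (pointwise (1/-inverseʳ g g₀)) ⟩
  1# * 1#
    ≈⟨ R.*-identityˡ 1# ⟩
  1# ∎)

-- Nonnegativity

⪰0-resp-≈ : ∀ {f g} → f ≈ g → g ⪰0 → f ⪰0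
⪰0-resp-≈ f≈g g⪰0 n = subst (0ℤ ℤ.≤_) (sym (coeff f≈g n)) (g⪰0 n)

*-nonneg : ∀ {a b} → 0ℤ ℤ.≤ a → 0ℤ ℤ.≤ b → 0ℤ ℤ.≤ a ℤ.* b
*-nonneg {+ a} {+ b} _ _ = subst (0ℤ ℤ.≤_) (ℤ.pos-* a b) (+≤+ z≤n)

sum-nonneg : ∀ n {t : Fin n → ℤ} → (∀ i → 0ℤ ℤ.≤ t i) → 0ℤ ℤ.≤ sum t
sum-nonneg zero    _   = ℤ.≤-refl
sum-nonneg (suc n) 0≤t = ℤ.+-mono-≤ (0≤t zero) (sum-nonneg n (0≤t ∘ suc))

+-⪰0 : ∀ {f g} → f ⪰0 → g ⪰0 → f + g ⪰0
+-⪰0 f⪰0 g⪰0 n = ℤ.+-mono-≤ (f⪰0 n) (g⪰0 n)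

*-⪰0 : ∀ {f g} → f ⪰0 → g ⪰0 → f * g ⪰0
*-⪰0 f⪰0 g⪰0 n = sum-nonneg (suc n) λ i → *-nonneg (f⪰0 (toℕ i)) (g⪰0 (n ∸ toℕ i))

constant-0-⪰0 : constant 0ℤ ⪰0
constant-0-⪰0 n = ℤ.≤-reflexive (sym (ℤ.*-zeroˡ (1# n)))

1#-⪰0 : 1# ⪰0
1#-⪰0 zero    = +≤+ z≤n
1#-⪰0 (suc _) = ℤ.≤-refl

q-⪰0 : q ⪰0
q-⪰0 zero          = ℤ.≤-refl
q-⪰0 (suc zero)    = +≤+ z≤n
q-⪰0 (suc (suc _)) = ℤ.≤-refl

^-⪰0 : ∀ {f} n → f ⪰0 → f ^ n ⪰0
^-⪰0 zero    f⪰0 = 1#-⪰0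
^-⪰0 (suc n) f⪰0 = *-⪰0 f⪰0 (^-⪰0 n f⪰0)

-- In positive degree 1 - f has the coefficients of -f. This sign cancels the minus of the
-- recursion, which therefore only adds products of nonnegative numbers.
recips-1-nonneg : ∀ {f} → f ⪰0 → ∀ n i → 0ℤ ℤ.≤ recips (1# - f) n i
recips-1-nonneg {f} f⪰0 (suc n) zero    = subst (0ℤ ℤ.≤_)
  (cong (ℤ._+_ (1# n)) (sym (neg-sum n λ i → trans
    (cong (ℤ._* recips (1# - f) n i) (ℤ.+-identityˡ (ℤ.- f (suc (toℕ i)))))
    (sym (ℤ.neg-distribˡ-* (f (suc (toℕ i))) (recips (1# - f) n i))))))
  (ℤ.+-mono-≤ (1#-⪰0 n) (sum-nonneg n λ i →
    *-nonneg (f⪰0 (suc (toℕ i))) (recips-1-nonneg f⪰0 n i)))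
  where
  neg-sum : ∀ n {s t : Fin n → ℤ} → (∀ i → s i ≡ ℤ.- t i) → ℤ.- sum s ≡ sum t
  neg-sum zero    _    = refl
  neg-sum (suc n) {s} {t} s≡-t = trans (ℤ.neg-distrib-+ (s zero) _) (cong₂ ℤ._+_
    (trans (cong ℤ.-_ (s≡-t zero)) (ℤ.neg-involutive (t zero)))
    (neg-sum n (s≡-t ∘ suc)))
recips-1-nonneg f⪰0 (suc n) (suc i) = recips-1-nonneg f⪰0 n i

1/1--⪰0 : ∀ {f} → f ⪰0 → 1/ (1# - f) ⪰0
1/1--⪰0 f⪰0 n = recips-1-nonneg f⪰0 (suc n) zero

1--constant : ∀ f → f 0 ≡ 0ℤ → (1# - f) 0 ≡ 1ℤ
1--constant f f₀ rewrite f₀ = refl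

1--inverseʳ : ∀ f → f 0 ≡ 0ℤ → (1# - f) * 1/ (1# - f) ≈ 1#
1--inverseʳ f f₀ = pointwise (1/-inverseʳ (1# - f) (1--constant f f₀))

-- The quotient is 1 + f + ... + f^(k-1), built up by 1 - f f^k = (1 - f) + f (1 - f^k).
geometric-⪰0 : ∀ {f} k → f 0 ≡ 0ℤ → f ⪰0 → (1# - f ^ k) * 1/ (1# - f) ⪰0
geometric-⪰0 {f} zero    f₀ f⪰0 = ⪰0-resp-≈
  (solve 1 (λ g → (con 1ℤ :- con 1ℤ) :* g := con 0ℤ) R.refl (1/ (1# - f)))
  constant-0-⪰0
geometric-⪰0 {f} (suc k) f₀ f⪰0 = ⪰0-resp-≈
  (begin
    (1# - f * f ^ k) * 1/ (1# - f)
      ≈⟨ solve 3 (λ f p g → (con 1ℤ :- f :* p) :* g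
           := (con 1ℤ :- f) :* g :+ f :* ((con 1ℤ :- p) :* g)) R.refl f (f ^ k) (1/ (1# - f)) ⟩
    (1# - f) * 1/ (1# - f) + f * ((1# - f ^ k) * 1/ (1# - f))
      ≈⟨ R.+-congʳ {f * ((1# - f ^ k) * 1/ (1# - f))} (1--inverseʳ f f₀) ⟩
    1# + f * ((1# - f ^ k) * 1/ (1# - f)) ∎)
  (+-⪰0 1#-⪰0 (*-⪰0 f⪰0 (geometric-⪰0 k f₀ f⪰0)))

-- q-Pochhammer symbols

*-zero-constant : ∀ f g → f 0 ≡ 0ℤ → (f * g) 0 ≡ 0ℤ
*-zero-constant f g f₀ rewrite f₀ = refl

⟨⨾⟩-constant : ∀ x p → x 0 ≡ 0ℤ → ∀ n → ⟨ x ⨾ p ⟩ n 0 ≡ 1ℤ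
⟨⨾⟩-constant x p x₀ zero    = refl
⟨⨾⟩-constant x p x₀ (suc n) = *-constant (⟨ x ⨾ p ⟩ n) (1# - x * p ^ n)
  (⟨⨾⟩-constant x p x₀ n) (1--constant (x * p ^ n) (*-zero-constant x (p ^ n) x₀))

⟨⨾⟩-congˡ : ∀ {x y} p → x ≈ y → ∀ n → ⟨ x ⨾ p ⟩ n ≈ ⟨ y ⨾ p ⟩ n
⟨⨾⟩-congˡ p x≈y zero    = R.refl
⟨⨾⟩-congˡ p x≈y (suc n) = R.*-cong (⟨⨾⟩-congˡ p x≈y n)
  (R.+-congˡ {1#} (R.-‿cong (R.*-congʳ {p ^ n} x≈y)))

1/⟨⨾⟩-suc : ∀ x p → x 0 ≡ 0ℤ → ∀ n →
            1/ ⟨ x ⨾ p ⟩ (suc n) ≈ 1/ ⟨ x ⨾ p ⟩ n * 1/ (1# - x * p ^ n)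
1/⟨⨾⟩-suc x p x₀ n = 1/-*-homo (⟨ x ⨾ p ⟩ n) (1# - x * p ^ n)
  (⟨⨾⟩-constant x p x₀ n) (1--constant (x * p ^ n) (*-zero-constant x (p ^ n) x₀))

1/⟨⨾⟩-⪰0 : ∀ {x p} → x 0 ≡ 0ℤ → x ⪰0 → p ⪰0 → ∀ n → 1/ ⟨ x ⨾ p ⟩ n ⪰0
1/⟨⨾⟩-⪰0 x₀ x⪰0 p⪰0 zero    = ⪰0-resp-≈ 1/1# 1#-⪰0
1/⟨⨾⟩-⪰0 {x} {p} x₀ x⪰0 p⪰0 (suc n) = ⪰0-resp-≈ (1/⟨⨾⟩-suc x p x₀ n)
  (*-⪰0 (1/⟨⨾⟩-⪰0 x₀ x⪰0 p⪰0 n) (1/1--⪰0 (*-⪰0 x⪰0 (^-⪰0 n p⪰0))))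

-- The factor of index 0 in the symbol is 1 - x, and its reciprocal absorbs `f`; the reciprocals of
-- all later factors are nonnegative. Hence the length must be a successor.
absorb-⪰0 : ∀ f {x p} → x 0 ≡ 0ℤ → x ⪰0 → p ⪰0 → f * 1/ (1# - x) ⪰0 →
            ∀ n → f * 1/ ⟨ x ⨾ p ⟩ (suc n) ⪰0
absorb-⪰0 f {x} x₀ x⪰0 p⪰0 h zero = ⪰0-resp-≈ (R.*-congˡ {f} (1/-cong (begin
  1# * (1# - x * 1#)
    ≈⟨ solve 1 (λ x → con 1ℤ :* (con 1ℤ :- x :* con 1ℤ) := con 1ℤ :- x) R.refl x ⟩
  1# - x ∎))) h
absorb-⪰0 f {x} {p} x₀ x⪰0 p⪰0 h (suc n) = ⪰0-resp-≈
  (begin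
    f * 1/ ⟨ x ⨾ p ⟩ (suc (suc n))
      ≈⟨ R.*-congˡ {f} (1/⟨⨾⟩-suc x p x₀ (suc n)) ⟩
    f * (1/ ⟨ x ⨾ p ⟩ (suc n) * 1/ (1# - x * p ^ suc n))
      ≈⟨ R.*-assoc f (1/ ⟨ x ⨾ p ⟩ (suc n)) (1/ (1# - x * p ^ suc n)) ⟨
    f * 1/ ⟨ x ⨾ p ⟩ (suc n) * 1/ (1# - x * p ^ suc n) ∎)
  (*-⪰0 (absorb-⪰0 f x₀ x⪰0 p⪰0 h n) (1/1--⪰0 (*-⪰0 x⪰0 (^-⪰0 (suc n) p⪰0))))

-- Truncation of infinite products

1/⟨⨾⟩-product : PowerSeries → ℕ → List PowerSeries → PowerSeries
1/⟨⨾⟩-product p m xs = foldr _*_ 1# (map (λ x → 1/ ⟨ x ⨾ p ⟩ m) xs)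

-- The theorem lists its exponents in increasing order; this moves the parameters that differ in
-- front of the common ones.
1/⟨⨾⟩-product-↭ : ∀ p m {xs ys} → xs ↭ ys → 1/⟨⨾⟩-product p m xs ≈ 1/⟨⨾⟩-product p m ys
1/⟨⨾⟩-product-↭ p m ↭-refl        = R.refl
1/⟨⨾⟩-product-↭ p m (prep x σ)    = R.*-congˡ {1/ ⟨ x ⨾ p ⟩ m} (1/⟨⨾⟩-product-↭ p m σ)
1/⟨⨾⟩-product-↭ p m (swap {xs} x y σ) = R.trans
  (x∙yz≈y∙xz (1/ ⟨ x ⨾ p ⟩ m) (1/ ⟨ y ⨾ p ⟩ m) (1/⟨⨾⟩-product p m xs))
  (R.*-congˡ {1/ ⟨ y ⨾ p ⟩ m} (R.*-congˡ {1/ ⟨ x ⨾ p ⟩ m} (1/⟨⨾⟩-product-↭ p m σ)))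
1/⟨⨾⟩-product-↭ p m (↭-trans σ τ) =
  R.trans (1/⟨⨾⟩-product-↭ p m σ) (1/⟨⨾⟩-product-↭ p m τ)

-- Coefficient n of a reciprocal depends only on degrees up to n, where each infinite symbol agrees
-- with its first m > n factors. The reciprocal of the finite product then splits.
1/⟨⨾⟩∞-truncate : ∀ {xs} p → p 0 ≡ 0ℤ → All (λ x → x 0 ≡ 0ℤ) xs → ∀ {n m} → n ℕ.< m →
                  (1/ ⟨ xs ⨾ p ⟩∞) n ≡ 1/⟨⨾⟩-product p m xs n
1/⟨⨾⟩∞-truncate {xs} p p₀ xs₀ {n} {m} n<m = trans
  (1/-cong-≤ n (λ k k≤n → agree xs k (ℕ.≤-<-trans k≤n n<m)))
  (coeff (1/-truncated xs₀) n)
  where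
  truncated : List PowerSeries → PowerSeries
  truncated xs = foldr _*_ 1# (map (λ x → ⟨ x ⨾ p ⟩ m) xs)

  agree : ∀ xs k → k ℕ.< m → ⟨ xs ⨾ p ⟩∞ k ≡ truncated xs k
  agree []       k k<m = refl
  agree (x ∷ xs) k k<m = *-cong-≤ k
    (λ j j≤k → sym (⟨⨾⟩-stable x p p₀ (ℕ.≤-<-trans j≤k k<m)))
    (λ j j≤k → agree xs j (ℕ.≤-<-trans j≤k k<m))

  truncated-constant : ∀ {xs} → All (λ x → x 0 ≡ 0ℤ) xs → truncated xs 0 ≡ 1ℤ
  truncated-constant []                  = refl
  truncated-constant {x ∷ xs} (x₀ ∷ xs₀) = *-constant (⟨ x ⨾ p ⟩ m) (truncated xs)
    (⟨⨾⟩-constant x p x₀ m) (truncated-constant xs₀)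

  1/-truncated : ∀ {xs} → All (λ x → x 0 ≡ 0ℤ) xs → 1/ truncated xs ≈ 1/⟨⨾⟩-product p m xs
  1/-truncated []                  = 1/1#
  1/-truncated {x ∷ xs} (x₀ ∷ xs₀) = R.trans
    (1/-*-homo (⟨ x ⨾ p ⟩ m) (truncated xs) (⟨⨾⟩-constant x p x₀ m) (truncated-constant xs₀))
    (R.*-congˡ {1/ ⟨ x ⨾ p ⟩ m} (1/-truncated xs₀))

-- Antitelescoping

-- This is 1/f - 1/g = (g - f)/(f g). Taking inverses `u`, `v` as data lets them be products of
-- reciprocals.
reciprocal-difference : ∀ f g u v → f * u ≈ 1# → g * v ≈ 1# →
                        u - v ≈ (g - f) * (u * v)
reciprocal-difference f g u v fu≈1 gv≈1 = begin
  u - v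
    ≈⟨ solve 2 (λ u v → u :- v := con 1ℤ :* u :- con 1ℤ :* v) R.refl u v ⟩
  1# * u - 1# * v
    ≈⟨ R.+-cong (R.*-congʳ {u} gv≈1) (R.-‿cong (R.*-congʳ {v} fu≈1)) ⟨
  g * v * u - f * u * v
    ≈⟨ solve 4 (λ f g u v → g :* v :* u :- f :* u :* v := (g :- f) :* (u :* v)) R.refl f g u v ⟩
  (g - f) * (u * v) ∎

*-inverse : ∀ f g u v → f * u ≈ 1# → g * v ≈ 1# → f * g * (u * v) ≈ 1#
*-inverse f g u v fu≈1 gv≈1 = begin
  f * g * (u * v)  ≈⟨ interchange f g u v ⟩
  f * u * (g * v)  ≈⟨ R.*-cong fu≈1 gv≈1 ⟩
  1# * 1#          ≈⟨ R.*-identityˡ 1# ⟩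
  1#               ∎

-- The terms 1 and x²yzw² cancel, leaving xw(1 - y - z + yz). It is applied with `w` equal to
-- `p ^ n`.
numerator-difference : ∀ x y z w →
  (1# - x * y * w) * (1# - x * z * w) - (1# - x * w) * (1# - x * (y * z) * w)
    ≈ x * w * ((1# - y) * (1# - z))
numerator-difference = solve 4 (λ x y z w →
  (con 1ℤ :- x :* y :* w) :* (con 1ℤ :- x :* z :* w)
    :- (con 1ℤ :- x :* w) :* (con 1ℤ :- x :* (y :* z) :* w)
  := x :* w :* ((con 1ℤ :- y) :* (con 1ℤ :- z))) R.refl

-- `s` stands for the reciprocals of the common symbols. It compensates for 1 - y, while 1/(1 - x)
-- compensates for 1 - z.
module _ {p x y z s : PowerSeries} (x₀ : x 0 ≡ 0ℤ)
         (p⪰0 : p ⪰0) (x⪰0 : x ⪰0) (y⪰0 : y ⪰0) (z⪰0 : z ⪰0)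
         (s⪰0 : (1# - y) * s ⪰0) (x-absorbs : (1# - z) * 1/ (1# - x) ⪰0)
         where

  private
    E : PowerSeries → ℕ → PowerSeries
    E u n = 1/ ⟨ u ⨾ p ⟩ n

    G : PowerSeries → ℕ → PowerSeries
    G u n = 1/ (1# - u * p ^ n)

    x*-₀ : ∀ u → (x * u) 0 ≡ 0ℤ
    x*-₀ u = *-zero-constant x u x₀

    D : PowerSeries → ℕ → PowerSeries
    D u n = 1# - u * p ^ n

    G-inverse : ∀ u → u 0 ≡ 0ℤ → ∀ n → D u n * G u n ≈ 1#
    G-inverse u u₀ n = 1--inverseʳ (u * p ^ n) (*-zero-constant u (p ^ n) u₀)

    GG-inverse : ∀ u v → u 0 ≡ 0ℤ → v 0 ≡ 0ℤ → ∀ n →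
                 D u n * D v n * (G u n * G v n) ≈ 1#
    GG-inverse u v u₀ v₀ n = *-inverse (D u n) (D v n) (G u n) (G v n)
      (G-inverse u u₀ n) (G-inverse v v₀ n)

    G-⪰0 : ∀ {u} → u ⪰0 → ∀ n → G u n ⪰0
    G-⪰0 u⪰0 n = 1/1--⪰0 (*-⪰0 u⪰0 (^-⪰0 n p⪰0))

    -- `U` and `V` are the partial products of the two sides; `A n` and `B n` are the factors that
    -- extend them from length n to n + 1.
    U V A B : ℕ → PowerSeries
    U n = E x n * E (x * (y * z)) n
    V n = E (x * y) n * E (x * z) n
    A n = G x n * G (x * (y * z)) n
    B n = G (x * y) n * G (x * z) n

    E*E-suc : ∀ u v → u 0 ≡ 0ℤ → v 0 ≡ 0ℤ → ∀ n →
              E u (suc n) * E v (suc n) ≈ E u n * E v n * (G u n * G v n)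
    E*E-suc u v u₀ v₀ n = R.trans
      (R.*-cong (1/⟨⨾⟩-suc u p u₀ n) (1/⟨⨾⟩-suc v p v₀ n))
      (interchange (E u n) (G u n) (E v n) (G v n))

    A-B : ∀ n → A n - B n ≈ x * p ^ n * ((1# - y) * (1# - z)) * (A n * B n)
    A-B n = R.trans
      (reciprocal-difference (D x n * D (x * (y * z)) n) (D (x * y) n * D (x * z) n) (A n) (B n)
        (GG-inverse x (x * (y * z)) x₀ (x*-₀ (y * z)) n)
        (GG-inverse (x * y) (x * z) (x*-₀ y) (x*-₀ z) n))
      (R.*-congʳ {A n * B n} (numerator-difference x y z (p ^ n)))

    B-⪰0 : ∀ n → B n ⪰0
    B-⪰0 n = *-⪰0 (G-⪰0 (*-⪰0 x⪰0 y⪰0) n) (G-⪰0 (*-⪰0 x⪰0 z⪰0) n)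

    -- The reciprocal of 1 - x occurs in `U` only from length one on, hence the successor.
    U-absorbs : ∀ n → (1# - z) * U (suc n) ⪰0
    U-absorbs n = ⪰0-resp-≈
      (R.sym (R.*-assoc (1# - z) (E x (suc n)) (E (x * (y * z)) (suc n))))
      (*-⪰0 (absorb-⪰0 (1# - z) x₀ x⪰0 p⪰0 x-absorbs n)
            (1/⟨⨾⟩-⪰0 (x*-₀ (y * z)) (*-⪰0 x⪰0 (*-⪰0 y⪰0 z⪰0)) p⪰0 (suc n)))

  -- Induction by UA - VB = U(A - B) + (U - V)B: the second term is the previous case times a
  -- nonnegative series, and the first contains the signs only through 1 - y and 1 - z.
  antitelescope-⪰0 : ∀ n →
    s * (1/ ⟨ x ⨾ p ⟩ n * 1/ ⟨ x * (y * z) ⨾ p ⟩ n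
         - 1/ ⟨ x * y ⨾ p ⟩ n * 1/ ⟨ x * z ⨾ p ⟩ n) ⪰0
  antitelescope-⪰0 zero = ⪰0-resp-≈
    (solve 2 (λ s i → s :* (i :* i :- i :* i) := con 0ℤ) R.refl s (1/ 1#)) constant-0-⪰0
  antitelescope-⪰0 (suc n) = ⪰0-resp-≈
    (begin
      s * (U (suc n) - V (suc n))
        ≈⟨ R.*-congˡ {s} (R.+-cong U-suc (R.-‿cong V-suc)) ⟩
      s * (U n * A n - V n * B n)
        ≈⟨ solve 5 (λ s u v a b →
             s :* (u :* a :- v :* b) := s :* u :* (a :- b) :+ s :* (u :- v) :* b)
             R.refl s (U n) (V n) (A n) (B n) ⟩
      s * U n * (A n - B n) + rest
        ≈⟨ R.+-congʳ {rest} (R.*-congˡ {s * U n} (A-B n)) ⟩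
      s * U n * (x * p ^ n * ((1# - y) * (1# - z)) * (A n * B n)) + rest
        -- Bring 1 - y next to `s`, and 1 - z next to `U n * A n`. The latter is `U (suc n)`, which
        -- contains 1/(1 - x) even when n = 0.
        ≈⟨ R.+-congʳ {rest} (antitelescope-term R.*-commutativeMonoid
             s (U n) (x * p ^ n) (1# - y) (1# - z) (A n) (B n)) ⟩
      (1# - y) * s * ((1# - z) * (U n * A n)) * (x * p ^ n * B n) + rest
        ≈⟨ R.+-congʳ {rest} (R.*-congʳ {x * p ^ n * B n}
             (R.*-congˡ {(1# - y) * s} (R.*-congˡ {1# - z} U-suc))) ⟨
      (1# - y) * s * ((1# - z) * U (suc n)) * (x * p ^ n * B n) + rest ∎)
    (+-⪰0
      (*-⪰0 (*-⪰0 s⪰0 (U-absorbs n)) (*-⪰0 (*-⪰0 x⪰0 (^-⪰0 n p⪰0)) (B-⪰0 n)))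
      (*-⪰0 (antitelescope-⪰0 n) (B-⪰0 n)))
    where
    U-suc : U (suc n) ≈ U n * A n
    U-suc = E*E-suc x (x * (y * z)) x₀ (x*-₀ (y * z)) n
    V-suc : V (suc n) ≈ V n * B n
    V-suc = E*E-suc (x * y) (x * z) (x*-₀ y) (x*-₀ z) n
    rest = s * (U n - V n) * B n

-- Passage to infinite products

-- The common parameters are `c ∷ cs`, with `c` the one that absorbs 1 - y. `u`, `v`, `w` are
-- separate variables because a power such as `q ^ 11` is in general only `≈` to the required
-- product.
1/⟨⨾⟩∞-difference-⪰0 : ∀ {p x y z u v w c cs xs ys} →
  p 0 ≡ 0ℤ → p ⪰0 → x 0 ≡ 0ℤ → x ⪰0 → y ⪰0 → z ⪰0 →
  All (λ a → a 0 ≡ 0ℤ) xs → All (λ a → a 0 ≡ 0ℤ) ys →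
  All (λ a → a 0 ≡ 0ℤ × a ⪰0) (c ∷ cs) →
  u ≈ x * (y * z) → v ≈ x * y → w ≈ x * z →
  (1# - y) * 1/ (1# - c) ⪰0 → (1# - z) * 1/ (1# - x) ⪰0 →
  xs ↭ x ∷ u ∷ c ∷ cs → ys ↭ v ∷ w ∷ c ∷ cs →
  1/ ⟨ xs ⨾ p ⟩∞ - 1/ ⟨ ys ⨾ p ⟩∞ ⪰0
1/⟨⨾⟩∞-difference-⪰0 {p} {x} {y} {z} {u} {v} {w} {c} {cs} {xs} {ys}
  p₀ p⪰0 x₀ x⪰0 y⪰0 z⪰0 xs₀ ys₀ ((c₀ , c⪰0) ∷ cs₀⪰0) u≈xyz v≈xy w≈xz c-absorbs x-absorbs σ τ n =
  subst (0ℤ ℤ.≤_)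
    (sym (cong₂ ℤ._-_ (1/⟨⨾⟩∞-truncate p p₀ xs₀ ℕ.≤-refl) (1/⟨⨾⟩∞-truncate p p₀ ys₀ ℕ.≤-refl)))
    (truncated-⪰0 n)
  where
  -- Enough factors to fix coefficient n, and at least one, as absorption requires.
  m = suc n

  E : PowerSeries → PowerSeries
  E a = 1/ ⟨ a ⨾ p ⟩ m

  s = 1/⟨⨾⟩-product p m (c ∷ cs)

  product-⪰0 : ∀ {as} → All (λ a → a 0 ≡ 0ℤ × a ⪰0) as → 1/⟨⨾⟩-product p m as ⪰0
  product-⪰0 []                = 1#-⪰0
  product-⪰0 ((a₀ , a⪰0) ∷ h) = *-⪰0 (1/⟨⨾⟩-⪰0 a₀ a⪰0 p⪰0 m) (product-⪰0 h)

  s-absorbed : (1# - y) * s ⪰0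
  s-absorbed = ⪰0-resp-≈ (R.sym (R.*-assoc (1# - y) (E c) (1/⟨⨾⟩-product p m cs)))
    (*-⪰0 (absorb-⪰0 (1# - y) c₀ c⪰0 p⪰0 c-absorbs n) (product-⪰0 cs₀⪰0))

  E-cong : ∀ {a b} → a ≈ b → E a ≈ E b
  E-cong a≈b = 1/-cong (⟨⨾⟩-congˡ p a≈b m)

  regroup : 1/⟨⨾⟩-product p m xs - 1/⟨⨾⟩-product p m ys
          ≈ s * (E x * E (x * (y * z)) - E (x * y) * E (x * z))
  regroup = begin
    1/⟨⨾⟩-product p m xs - 1/⟨⨾⟩-product p m ys
      ≈⟨ R.+-cong (1/⟨⨾⟩-product-↭ p m σ) (R.-‿cong (1/⟨⨾⟩-product-↭ p m τ)) ⟩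
    E x * (E u * s) - E v * (E w * s)
      ≈⟨ solve 5 (λ a b c d s → a :* (b :* s) :- c :* (d :* s) := s :* (a :* b :- c :* d))
           R.refl (E x) (E u) (E v) (E w) s ⟩
    s * (E x * E u - E v * E w)
      ≈⟨ R.*-congˡ {s} (R.+-cong (R.*-congˡ {E x} (E-cong u≈xyz))
           (R.-‿cong (R.*-cong (E-cong v≈xy) (E-cong w≈xz)))) ⟩
    s * (E x * E (x * (y * z)) - E (x * y) * E (x * z)) ∎

  truncated-⪰0 : 1/⟨⨾⟩-product p m xs - 1/⟨⨾⟩-product p m ys ⪰0
  truncated-⪰0 = ⪰0-resp-≈ {g = s * (E x * E (x * (y * z)) - E (x * y) * E (x * z))} regroup
    (antitelescope-⪰0 {s = s} x₀ p⪰0 x⪰0 y⪰0 z⪰0 s-absorbed x-absorbs m)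

-- The two inequalities

^-homo-* : ∀ f m n → f ^ (m ℕ.+ n) ≈ f ^ m * f ^ n
^-homo-* f zero    n = R.sym (R.*-identityˡ (f ^ n))
^-homo-* f (suc m) n = R.trans
  (R.*-congˡ {f} (^-homo-* f m n)) (R.sym (R.*-assoc f (f ^ m) (f ^ n)))

proposition3p1 : (1/ ⟨ q ∷ q ^ 4 ∷ q ^ 5 ∷ q ^ 9 ∷ q ^ 11 ∷ [] ⨾ q ^ 12 ⟩∞
    - 1/ ⟨ q ∷ q ^ 5 ∷ q ^ 7 ∷ q ^ 8 ∷ q ^ 9 ∷ [] ⨾ q ^ 12 ⟩∞ ⪰0)
    ×
    (1/ ⟨ q ∷ q ^ 3 ∷ q ^ 7 ∷ q ^ 8 ∷ q ^ 11 ∷ [] ⨾ q ^ 12 ⟩∞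
    - 1/ ⟨ q ^ 3 ∷ q ^ 4 ∷ q ^ 5 ∷ q ^ 7 ∷ q ^ 11 ∷ [] ⨾ q ^ 12 ⟩∞ ⪰0)
proposition3p1 = first , second
  where
  q^⪰0 : ∀ k → q ^ k ⪰0
  q^⪰0 k = ^-⪰0 k q-⪰0

  q^₀ : ∀ k → (q ^ suc k) 0 ≡ 0ℤ
  q^₀ k = *-zero-constant q (q ^ k) refl

  q^-₀⪰0 : ∀ k → (q ^ suc k) 0 ≡ 0ℤ × q ^ suc k ⪰0
  q^-₀⪰0 k = q^₀ k , q^⪰0 (suc k)

  1--inverse-⪰0 : ∀ k → (1# - q ^ suc k) * 1/ (1# - q ^ suc k) ⪰0
  1--inverse-⪰0 k = ⪰0-resp-≈ (1--inverseʳ (q ^ suc k) (q^₀ k)) 1#-⪰0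

  first : 1/ ⟨ q ∷ q ^ 4 ∷ q ^ 5 ∷ q ^ 9 ∷ q ^ 11 ∷ [] ⨾ q ^ 12 ⟩∞
    - 1/ ⟨ q ∷ q ^ 5 ∷ q ^ 7 ∷ q ^ 8 ∷ q ^ 9 ∷ [] ⨾ q ^ 12 ⟩∞ ⪰0
  -- With x = q⁴, y = q³, z = q⁴: xyz = q¹¹, xy = q⁷, xz = q⁸, and q, q⁵, q⁹ are common.
  first = 1/⟨⨾⟩∞-difference-⪰0 {p = q ^ 12} {x = q ^ 4} {y = q ^ 3} {z = q ^ 4}
    {u = q ^ 11} {v = q ^ 7} {w = q ^ 8} {c = q} {cs = q ^ 5 ∷ q ^ 9 ∷ []}
    {xs = q ∷ q ^ 4 ∷ q ^ 5 ∷ q ^ 9 ∷ q ^ 11 ∷ []}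
    {ys = q ∷ q ^ 5 ∷ q ^ 7 ∷ q ^ 8 ∷ q ^ 9 ∷ []}
    (q^₀ 11) (q^⪰0 12) (q^₀ 3) (q^⪰0 4) (q^⪰0 3) (q^⪰0 4)
    (refl ∷ q^₀ 3 ∷ q^₀ 4 ∷ q^₀ 8 ∷ q^₀ 10 ∷ [])
    (refl ∷ q^₀ 4 ∷ q^₀ 6 ∷ q^₀ 7 ∷ q^₀ 8 ∷ [])
    ((refl , q-⪰0) ∷ q^-₀⪰0 4 ∷ q^-₀⪰0 8 ∷ [])
    (R.trans (^-homo-* q 4 7) (R.*-congˡ {q ^ 4} (^-homo-* q 3 4)))
    (^-homo-* q 4 3) (^-homo-* q 4 4)
    -- (1 - q³)/(1 - q) = 1 + q + q², and 1 - z cancels against 1 - x since z = x.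
    (geometric-⪰0 3 refl q-⪰0) (1--inverse-⪰0 3)
    (↭-trans (shift (q ^ 4) (q ∷ []) _) (prep (q ^ 4) (shift (q ^ 11) (q ∷ q ^ 5 ∷ q ^ 9 ∷ []) [])))
    (↭-trans (shift (q ^ 7) (q ∷ q ^ 5 ∷ []) _) (prep (q ^ 7) (shift (q ^ 8) (q ∷ q ^ 5 ∷ []) _)))

  second : 1/ ⟨ q ∷ q ^ 3 ∷ q ^ 7 ∷ q ^ 8 ∷ q ^ 11 ∷ [] ⨾ q ^ 12 ⟩∞
    - 1/ ⟨ q ^ 3 ∷ q ^ 4 ∷ q ^ 5 ∷ q ^ 7 ∷ q ^ 11 ∷ [] ⨾ q ^ 12 ⟩∞ ⪰0
  -- With x = q, y = q³, z = q⁴: xyz = q⁸, xy = q⁴, xz = q⁵, and q³, q⁷, q¹¹ are common.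
  second = 1/⟨⨾⟩∞-difference-⪰0 {p = q ^ 12} {x = q} {y = q ^ 3} {z = q ^ 4}
    {u = q ^ 8} {v = q ^ 4} {w = q ^ 5} {c = q ^ 3} {cs = q ^ 7 ∷ q ^ 11 ∷ []}
    {xs = q ∷ q ^ 3 ∷ q ^ 7 ∷ q ^ 8 ∷ q ^ 11 ∷ []}
    {ys = q ^ 3 ∷ q ^ 4 ∷ q ^ 5 ∷ q ^ 7 ∷ q ^ 11 ∷ []}
    (q^₀ 11) (q^⪰0 12) refl q-⪰0 (q^⪰0 3) (q^⪰0 4)
    (refl ∷ q^₀ 2 ∷ q^₀ 6 ∷ q^₀ 7 ∷ q^₀ 10 ∷ [])
    (q^₀ 2 ∷ q^₀ 3 ∷ q^₀ 4 ∷ q^₀ 6 ∷ q^₀ 10 ∷ [])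
    (q^-₀⪰0 2 ∷ q^-₀⪰0 6 ∷ q^-₀⪰0 10 ∷ [])
    (R.*-congˡ {q} (^-homo-* q 3 4)) R.refl R.refl
    -- Now c = y, so 1 - y cancels, and (1 - q⁴)/(1 - q) = 1 + q + q² + q³.
    (1--inverse-⪰0 2) (geometric-⪰0 4 refl q-⪰0)
    (prep q (shift (q ^ 8) (q ^ 3 ∷ q ^ 7 ∷ []) _))
    (↭-trans (shift (q ^ 4) (q ^ 3 ∷ []) _) (prep (q ^ 4) (shift (q ^ 5) (q ^ 3 ∷ []) _)))
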